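{- Suppose that $\Gamma$ is a consistent set of s-formulas in $\mathcal{F}_1$, $\phi$ is an s-formula in $\mathcal{F}_1$, and every frame that satisfies $\Gamma$ satisfies $\phi$. Then there is a derivation of $\phi$ from $\Gamma$ using the rules (I), (HS), and (N) of the deductive system for $\mathcal{F}_1$.
   Context: Fix an infinite (possibly uncountable) set $\Sigma$ of propositional variables. The fragment $\mathcal{F}_1$ consists of all formal expressions (s-formulas) $X\prec Y$ (strict implication) and $X\not\prec Y$ (strict nonimplication), where $X$ and $Y$ are individual propositional variables; $\prec$ and $\not\prec$ are two formal symbols. A valuation is a function $w:\Sigma\to\{T,F\}$. A frame is a nonempty set of valuations. A frame $R$ satisfies $X \prec Y$ if for every $w\in R$, $w(X)=F$ or $w(Y)=T$. A frame $R$ satisfies $X\not\prec Y$ if there is some $w\in R$ with $w(X)=T$ and $w(Y)=F$. A frame satisfies a set $\Gamma$ of s-formulas if it satisfies every member. $\Gamma$ is consistent if some frame satisfies it. The deductive system for $\mathcal{F}_1$ consists of the following rule schemes, where $W,X,Y,Z$ range over arbitrary propositional variables: - (I) Deduce $X\prec X$ (no premises). - (HS) From $X\prec Y$ and $Y\prec Z$, deduce $X\prec Z$. - (N) From $X\not\prec Y$, $X\prec W$, and $Z\prec Y$, deduce $W\not\prec Z$. A derivation of $\phi$ from $\Gamma$ is a finite derivation of $\phi$ from members of $\Gamma$ using these rules. -}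

module Defs where

open import Data.Bool.Base using (Bool; true; false)
open import Data.Fin.Base using (Fin)
open import Data.Nat.Base using (ℕ)
open import Data.Product.Base using (_×_; ∃-syntax)
open import Data.Sum.Base using (_⊎_)
open import Function.Bundles using (_↔_)
open import Level using (Level; suc)
open import Relation.Binary.PropositionalEquality.Core using (_≡_)
open import Relation.Nullary.Negation.Core using (¬_)
open import Relation.Unary using (Pred; _∈_; Satisfiable)

private
  variable
    ℓ : Level

Infinite : Set ℓ → Set ℓ
Infinite A = ∀ (n : ℕ) → ¬ (A ↔ Fin n)

module F₁ {ℓ : Level} (V : Set ℓ) where

  infix 6 _≺_ _⊀_
  infix 4 _⊨_ _⊨*_ _⊢_

  data SFormula : Set ℓ where
    _≺_ : V → V → SFormula
    _⊀_ : V → V → SFormula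

  Valuation : Set ℓ
  Valuation = V → Bool

  record Frame : Set (suc ℓ) where
    field
      valuations : Pred Valuation ℓ
      nonempty   : Satisfiable valuations

  open Frame public

  _⊨_ : Frame → SFormula → Set ℓ
  R ⊨ X ≺ Y = ∀ w → w ∈ valuations R → w X ≡ false ⊎ w Y ≡ true
  R ⊨ X ⊀ Y = ∃[ w ] w ∈ valuations R × w X ≡ true × w Y ≡ false

  _⊨*_ : Frame → Pred SFormula ℓ → Set ℓ
  R ⊨* Γ = ∀ ψ → ψ ∈ Γ → R ⊨ ψ

  Consistent : Pred SFormula ℓ → Set (suc ℓ)
  Consistent Γ = ∃[ R ] R ⊨* Γ

  data _⊢_ (Γ : Pred SFormula ℓ) : SFormula → Set ℓ where
    premise : ∀ {ψ} → ψ ∈ Γ → Γ ⊢ ψ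
    I       : ∀ {X} → Γ ⊢ X ≺ X
    HS      : ∀ {X Y Z} → Γ ⊢ X ≺ Y → Γ ⊢ Y ≺ Z → Γ ⊢ X ≺ Z
    N       : ∀ {W X Y Z} → Γ ⊢ X ⊀ Y → Γ ⊢ X ≺ W → Γ ⊢ Z ≺ Y → Γ ⊢ W ⊀ Z

{-# OPTIONS --safe #-}

-- The frame refuting an underivable φ consists of all valuations closed under
-- the derivable strict implications, from which, when φ is W ⊀ Z, those
-- separating W from Z are removed.  An X ⊀ Y in Γ is still witnessed there:
-- the up-set of variables A with Γ ⊢ X ≺ A omits Y by consistency, and so does
-- the up-set of those with Γ ⊬ A ≺ Y, which contains X.  If both separated W
-- from Z, then Γ ⊢ X ≺ W and Γ ⊢ Z ≺ Y, and (N) would derive W ⊀ Z.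
module Submission where

open import Defs
open import Axiom.DoubleNegationElimination using (em⇒dne)
open import Axiom.ExcludedMiddle using (ExcludedMiddle)
open import Data.Bool.Base using (true; false)
open import Data.Product.Base using (_,_)
open import Data.Sum.Base using (_⊎_; inj₁; inj₂)
open import Data.Unit.Base using (⊤; tt)
open import Level using (Level; Lift; lift)
open import Relation.Binary.PropositionalEquality using (_≡_; refl)
open import Relation.Nullary using (¬_; does; yes; no; contradiction)
open import Relation.Nullary.Decidable using (dec-true; dec-false)
open import Relation.Unary using (Pred; _∈_; _∉_; _∩_; Satisfiable)

true≢false : ∀ {b} → b ≡ true → ¬ b ≡ false
true≢false refl ()

material⇒⊎ : ∀ {a b} → (a ≡ true → b ≡ true) → a ≡ false ⊎ b ≡ true
material⇒⊎ {false} f = inj₁ refl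
material⇒⊎ {true}  f = inj₂ (f refl)

⊎⇒material : ∀ {a b} → a ≡ false ⊎ b ≡ true → a ≡ true → b ≡ true
⊎⇒material (inj₁ a≡f) a≡t = contradiction a≡f (true≢false a≡t)
⊎⇒material (inj₂ b≡t) _   = b≡t

contraposition : ∀ {a b} → (a ≡ true → b ≡ true) → b ≡ false → a ≡ false
contraposition {false} f _   = refl
contraposition {true}  f b≡f = contradiction b≡f (true≢false (f refl))

module _ {ℓ : Level} {V : Set ℓ} where
  open F₁ V

  soundness : ∀ {Γ ψ} (R : Frame) → R ⊨* Γ → Γ ⊢ ψ → R ⊨ ψ
  soundness R R⊨Γ (premise ψ∈Γ) = R⊨Γ _ ψ∈Γ
  soundness R R⊨Γ I w w∈R = material⇒⊎ λ wX → wX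
  soundness R R⊨Γ (HS d e) w w∈R = material⇒⊎ λ wX →
    ⊎⇒material (soundness R R⊨Γ e w w∈R) (⊎⇒material (soundness R R⊨Γ d w w∈R) wX)
  -- The witness is kept: truth passes from `X` to `W`, and falsity passes back from `Y` to `Z`.
  soundness R R⊨Γ (N d e f) with soundness R R⊨Γ d
  ... | w , w∈R , wX , wY =
    w , w∈R , ⊎⇒material (soundness R R⊨Γ e w w∈R) wX
      , contraposition (⊎⇒material (soundness R R⊨Γ f w w∈R)) wY

  -- By soundness, a model of `Γ` deriving `X ≺ Y` could not contain the valuation that witnesses
  -- `X ⊀ Y`.
  consistent⇒⊬ : ∀ {Γ X Y} → Consistent Γ → X ⊀ Y ∈ Γ → ¬ Γ ⊢ X ≺ Y
  consistent⇒⊬ (R , R⊨Γ) X⊀Y∈Γ d with R⊨Γ _ X⊀Y∈Γ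
  ... | w , w∈R , wX , wY =
    true≢false (⊎⇒material (soundness R R⊨Γ d w w∈R) wX) wY

  module _ (em : ExcludedMiddle ℓ) (Γ : Pred SFormula ℓ) where

    Closed : Pred Valuation ℓ
    Closed w = ∀ {A B} → Γ ⊢ A ≺ B → w A ≡ true → w B ≡ true

    UpSet : Pred (Pred V ℓ) ℓ
    UpSet P = ∀ {A B} → Γ ⊢ A ≺ B → A ∈ P → B ∈ P

    indicator : Pred V ℓ → Valuation
    indicator P A = does (em {P = P A})

    ∈⇒true : ∀ P {A} → A ∈ P → indicator P A ≡ true
    ∈⇒true P = dec-true em

    ∉⇒false : ∀ P {A} → A ∉ P → indicator P A ≡ false
    ∉⇒false P = dec-false em

    true⇒∈ : ∀ P {A} → indicator P A ≡ true → A ∈ P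
    true⇒∈ P eq = em⇒dne em λ A∉P → true≢false eq (∉⇒false P A∉P)

    indicator-closed : ∀ {P} → UpSet P → Closed (indicator P)
    indicator-closed {P} up d eq = ∈⇒true P (up d (true⇒∈ P eq))

    -- By (I) and (HS), `Above X` is the least up-set containing `X`, and `NotBelow Y` the greatest
    -- one omitting `Y`.
    Above : V → Pred V ℓ
    Above X A = Γ ⊢ X ≺ A

    NotBelow : V → Pred V ℓ
    NotBelow Y A = ¬ Γ ⊢ A ≺ Y

    above-closed : ∀ X → Closed (indicator (Above X))
    above-closed X = indicator-closed λ d e → HS e d

    notBelow-closed : ∀ Y → Closed (indicator (NotBelow Y))
    notBelow-closed Y = indicator-closed λ d ¬e e → ¬e (HS d e)

    closedFrame : (P : Pred Valuation ℓ) → Satisfiable (Closed ∩ P) → Frame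
    closedFrame P ne = record { valuations = Closed ∩ P ; nonempty = ne }

    -- Closed valuations respect every strict implication in `Γ`, whatever `P` removes, so only the
    -- nonimplications need witnesses.
    closedFrame-⊨* : ∀ P ne →
      (∀ {X Y} → X ⊀ Y ∈ Γ → closedFrame P ne ⊨ X ⊀ Y) →
      closedFrame P ne ⊨* Γ
    closedFrame-⊨* P ne wit (X ≺ Y) ψ∈Γ w (cl , _) = material⇒⊎ (cl (premise ψ∈Γ))
    closedFrame-⊨* P ne wit (X ⊀ Y) ψ∈Γ = wit ψ∈Γ

    module _ (con : Consistent Γ) where

      -- Validity is tested at a single valuation, the indicator of `Above X`: it makes `X` true,
      -- hence `Y`, and truth there is derivability from `X`.
      complete-≺ : ∀ {X Y} → (∀ R → R ⊨* Γ → R ⊨ X ≺ Y) → Γ ⊢ X ≺ Y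
      complete-≺ {X} valid = true⇒∈ (Above X)
        (⊎⇒material (valid R R⊨Γ (indicator (Above X)) (above-closed X , lift tt))
          (∈⇒true (Above X) I))
        where
        Any : Pred Valuation ℓ
        Any _ = Lift ℓ ⊤

        ne : Satisfiable (Closed ∩ Any)
        ne = (λ _ → true) , (λ _ _ → refl) , lift tt

        R : Frame
        R = closedFrame Any ne

        R⊨Γ : R ⊨* Γ
        R⊨Γ = closedFrame-⊨* Any ne λ {A} A⊀B∈Γ →
          indicator (Above A) , (above-closed A , lift tt) , ∈⇒true (Above A) I
            , ∉⇒false (Above A) (consistent⇒⊬ con A⊀B∈Γ)

      complete-⊀ : ∀ {W Z} → (∀ R → R ⊨* Γ → R ⊨ W ⊀ Z) → Γ ⊢ W ⊀ Z
      complete-⊀ {W} {Z} valid = em⇒dne em λ ⊬W⊀Z →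
        -- A witness of `W ⊀ Z` in `R` separates `W` from `Z`, which membership in `R` forbids.
        let _ , (_ , lift keeps) , wW , wZ = valid R (R⊨Γ ⊬W⊀Z)
        in true≢false (keeps wW) wZ
        where
        NonSeparating : Pred Valuation ℓ
        NonSeparating w = Lift ℓ (w W ≡ true → w Z ≡ true)

        ne : Satisfiable (Closed ∩ NonSeparating)
        -- The constant valuation separates nothing, so it survives the removal even if `Γ` is
        -- empty.
        ne = (λ _ → true) , (λ _ _ → refl) , lift λ _ → refl

        R : Frame
        R = closedFrame NonSeparating ne

        witness : ¬ Γ ⊢ W ⊀ Z → ∀ {X Y} → X ⊀ Y ∈ Γ → R ⊨ X ⊀ Y
        -- `Above X` is harmless exactly when it makes `W` false or `Z` true; the split tests the
        -- first, and if it fails `NotBelow Y` makes `Z` true.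
        witness ⊬W⊀Z {X} {Y} X⊀Y∈Γ with em {P = Γ ⊢ X ≺ W}
        ... | no ⊬X≺W =
          indicator (Above X)
            , (above-closed X , lift λ wW → contradiction (true⇒∈ (Above X) wW) ⊬X≺W)
            , ∈⇒true (Above X) I
            , ∉⇒false (Above X) (consistent⇒⊬ con X⊀Y∈Γ)
        ... | yes X≺W =
          indicator (NotBelow Y)
            , (notBelow-closed Y , lift λ _ →
                ∈⇒true (NotBelow Y) λ Z≺Y → ⊬W⊀Z (N (premise X⊀Y∈Γ) X≺W Z≺Y))
            , ∈⇒true (NotBelow Y) (consistent⇒⊬ con X⊀Y∈Γ)
            , ∉⇒false (NotBelow Y) λ ⊬Y≺Y → ⊬Y≺Y I

        R⊨Γ : ¬ Γ ⊢ W ⊀ Z → R ⊨* Γ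
        R⊨Γ ⊬W⊀Z = closedFrame-⊨* NonSeparating ne (witness ⊬W⊀Z)

theorem20 : ∀ {ℓ : Level} → ExcludedMiddle ℓ →
    (V : Set ℓ) → Infinite V →
    let open F₁ V in
    (Γ : Pred SFormula ℓ) (φ : SFormula) →
    Consistent Γ →
    (∀ (R : Frame) → R ⊨* Γ → R ⊨ φ) →
    Γ ⊢ φ
theorem20 em V _ Γ (X F₁.≺ Y) con valid = complete-≺ em Γ con valid
theorem20 em V _ Γ (X F₁.⊀ Y) con valid = complete-⊀ em Γ con valid
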